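{- For every integer $n\ge 4$, $$p(n)=\binom{n-1}{\lfloor n/2\rfloor-1}.$$
   Context: For a vector $\mathbf{v}\in\{0,1\}^n$ and $r\in[n]=\{1,\ldots,n\}$, $\mathbf{v}[r]$ denotes its $r$-th coordinate. A set of binary vectors $\mathcal{V}=\{\mathbf{v}_1,\ldots,\mathbf{v}_k\}\subseteq\{0,1\}^n$ is called perfect if (i) $|\mathcal{V}|\ge 2$, and (ii) for every pair $(\mathbf{v}_i,\mathbf{v}_j)$ with $1\le i<j\le k$ and every $\alpha\in\{0,1\}^2$, there is some $r\in[n]$ with $\mathbf{v}_i[r]\,\mathbf{v}_j[r]=\alpha$. For $n\ge 4$ (for which perfect sets exist), $p(n)$ denotes the maximum size of a perfect set of vectors of length $n$. -}

module Defs where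

open import Data.Bool.Base using (Bool)
open import Data.List.Base using (List; length)
open import Data.List.Relation.Unary.AllPairs using (AllPairs)
open import Data.List.Relation.Unary.Unique.Propositional using (Unique)
open import Data.Nat.Base using (ℕ; _≤_)
open import Data.Product.Base using (∃-syntax; _×_; _,_)
open import Data.Vec.Base using (Vec; lookup)
open import Relation.Binary.PropositionalEquality.Core using (_≡_)

-- {0,1}ⁿ, with false for 0 and true for 1.
BinaryVector : ℕ → Set
BinaryVector n = Vec Bool n

-- A finite subset of {0,1}ⁿ is given by a duplicate-free enumeration
-- v₁, …, vₖ of its elements, so its cardinality is the length of the list.
record VectorSet (n : ℕ) : Set where
  field
    elements : List (BinaryVector n)
    unique   : Unique elements

  size : ℕ
  size = length elements

open VectorSet public

RealisesAll : ∀ {n} → BinaryVector n → BinaryVector n → Set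
RealisesAll {n} v w =
  (α : Bool × Bool) → ∃[ r ] (lookup v r , lookup w r) ≡ α

-- AllPairs relates exactly the pairs (vᵢ, vⱼ) with i < j.
record Perfect {n : ℕ} (V : VectorSet n) : Set where
  field
    size≥2   : 2 ≤ size V
    pairwise : AllPairs RealisesAll (elements V)

IsMaximumOf : (ℕ → Set) → ℕ → Set
IsMaximumOf P m = P m × (∀ k → P k → k ≤ m)

IsPerfectSize : ℕ → ℕ → Set
IsPerfectSize n k = ∃[ V ] Perfect {n} V × size V ≡ k

-- The maximum is specified by its graph, since it is undefined for n < 4,
-- where no perfect set exists.
p[_]≡_ : ℕ → ℕ → Set
p[ n ]≡ m = IsMaximumOf (IsPerfectSize n) m

{-# OPTIONS --safe #-}
-- Upper bound (Katona's cycle method).  Complementing members of a perfect set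
-- keeps it perfect, so let every member have at most m = ⌊n/2⌋ ones.  For an
-- ordering π of [n] and i ∈ ℤ/n, the cyclic arcs starting at i of lengths 0, …, m
-- form a chain Cᵢ, and all its members are disjoint from those of Cᵢ₊ₘ.  Members of
-- a perfect set are incomparable and meet pairwise, so Cᵢ and Cᵢ₊ₘ together contain
-- at most one of them; summing over i, at most ⌊n/2⌋ members are arcs of π.  A set
-- of size j ≤ m is an arc of n · j! (n-j)! ≥ n · m! (n-m)! of the n! orderings,
-- and double counting bounds the number of members by (m/n) · C(n,m) = C(n-1,m-1).
--
-- Equality: all sets of size m containing the first element.
module Submission where

open import Data.Nat.Base using (ℕ; _≤_; _∸_; ⌊_/2⌋)
open import Data.Nat.Combinatorics using (_C_)
open import Defs

open import Data.Bool.Base using (Bool; true; false; not; T)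
import Data.Bool.Properties as Bool
open import Data.Empty using (⊥)
open import Data.Fin.Base using (Fin; zero; suc; toℕ)
open import Data.Fin.Properties using (toℕ<n)
open import Data.Fin.Subset using (∣_∣; ∁)
open import Data.Fin.Subset.Properties using (∣p∣≤n; ∣∁p∣≡n∸∣p∣)
open import Data.List.Base
  using (List; []; _∷_; _++_; concatMap; length; map; applyUpTo; upTo)
open import Data.List.Properties
  using (map-++; map-∘; map-cong; length-++; length-map; length-upTo; map-upTo;
         applyUpTo-∷ʳ)
open import Data.List.Membership.Propositional.Properties using (∈-map⁻)
open import Data.List.Relation.Unary.All as All using (All; []; _∷_)
import Data.List.Relation.Unary.All.Properties as All
open import Data.List.Relation.Unary.AllPairs as AllPairs using (AllPairs; []; _∷_)
import Data.List.Relation.Unary.AllPairs.Properties as AllPairs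
open import Data.List.Relation.Unary.Unique.Propositional using (Unique)
import Data.List.Relation.Unary.Unique.Propositional.Properties as Unique
open import Data.Nat.Base
  using (zero; suc; _+_; _*_; _<_; _<ᵇ_; ⌈_/2⌉; _!; z≤n; s≤s; NonZero)
open import Data.Nat.Combinatorics
  using (nCk+nC[k+1]≡[n+1]C[k+1]; nCk≡n!/k![n-k]!; k![n∸k]!∣n!)
open import Data.Nat.DivMod
  using (_%_; [m+n]%n≡m%n; m<n⇒m%n≡m; %-distribˡ-+; m/n*n≡m)
open import Data.Nat.ListAction using (sum)
open import Data.Nat.ListAction.Properties using (sum-++)
open import Data.Nat.Properties hiding (_≟_)
open import Data.Nat.Tactic.RingSolver using (solve-∀)
open import Data.Product.Base using (∃-syntax; _×_; _,_)
open import Data.Product.Properties using (,-injectiveˡ; ,-injectiveʳ)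
open import Data.Sum.Base using (_⊎_; inj₁; inj₂)
open import Data.Vec.Base as Vec using (Vec; []; _∷_; lookup; allFin; tabulate)
import Data.Vec.Properties as Vec
open import Function.Base using (_∘_)
open import Relation.Binary.PropositionalEquality
  using (_≡_; _≢_; refl; sym; trans; cong; cong₂; subst; module ≡-Reasoning)
open import Relation.Nullary using (Dec; yes; no; ¬_; contradiction; _⊎-dec_)

-- Finite sums

∑ : {A : Set} → List A → (A → ℕ) → ℕ
∑ xs f = sum (map f xs)

module _ {A : Set} where

  ∑-cong : ∀ (xs : List A) {f g} → (∀ x → f x ≡ g x) → ∑ xs f ≡ ∑ xs g
  ∑-cong xs f≗g = cong sum (map-cong f≗g xs)

  ∑-mono : ∀ {xs : List A} {f g} → All (λ x → f x ≤ g x) xs → ∑ xs f ≤ ∑ xs g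
  ∑-mono []       = z≤n
  ∑-mono (p ∷ ps) = +-mono-≤ p (∑-mono ps)

  ∑-const : ∀ (xs : List A) c → ∑ xs (λ _ → c) ≡ length xs * c
  ∑-const []       c = refl
  ∑-const (_ ∷ xs) c = cong (c +_) (∑-const xs c)

  ∑-+ : ∀ (xs : List A) f g → ∑ xs (λ x → f x + g x) ≡ ∑ xs f + ∑ xs g
  ∑-+ []       f g = refl
  ∑-+ (x ∷ xs) f g = trans (cong (f x + g x +_) (∑-+ xs f g))
                           (interchange (f x) (g x) (∑ xs f) (∑ xs g))
    where
    interchange : ∀ a b c d → a + b + (c + d) ≡ a + c + (b + d)
    interchange = solve-∀

  ∑-*ˡ : ∀ (xs : List A) c f → ∑ xs (λ x → c * f x) ≡ c * ∑ xs f
  ∑-*ˡ []       c f = sym (*-zeroʳ c)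
  ∑-*ˡ (x ∷ xs) c f = trans (cong (c * f x +_) (∑-*ˡ xs c f))
                            (sym (*-distribˡ-+ c (f x) (∑ xs f)))

  ∑-++ : ∀ (xs ys : List A) f → ∑ (xs ++ ys) f ≡ ∑ xs f + ∑ ys f
  ∑-++ xs ys f = trans (cong sum (map-++ f xs ys)) (sum-++ (map f xs) (map f ys))

  ∑≡0 : ∀ {xs : List A} {f} → All (λ x → f x ≡ 0) xs → ∑ xs f ≡ 0
  ∑≡0 []       = refl
  ∑≡0 (p ∷ ps) = cong₂ _+_ p (∑≡0 ps)

  -- Of any two terms one vanishes, so everything after the first nonzero term is `0`.
  ∑≤1 : ∀ {xs : List A} {f} → All (λ x → f x ≤ 1) xs →
        AllPairs (λ x y → f x ≡ 0 ⊎ f y ≡ 0) xs → ∑ xs f ≤ 1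
  ∑≤1 [] [] = z≤n
  ∑≤1 {xs = x ∷ xs} {f} (fx≤1 ∷ ≤1) (p ∷ ps) with f x
  ... | zero  = ∑≤1 ≤1 ps
  ... | suc k = begin
    suc k + ∑ xs f  ≡⟨ cong (suc k +_) (∑≡0 (All.map (λ { (inj₂ e) → e }) p)) ⟩
    suc k + 0       ≡⟨ +-identityʳ (suc k) ⟩
    suc k           ≤⟨ fx≤1 ⟩
    1               ∎
    where open ≤-Reasoning

module _ {A B : Set} where

  ∑-map : ∀ (g : A → B) xs f → ∑ (map g xs) f ≡ ∑ xs (f ∘ g)
  ∑-map g xs f = cong sum (sym (map-∘ xs))

  ∑-concatMap : ∀ (h : A → List B) xs f →
                ∑ (concatMap h xs) f ≡ ∑ xs (λ x → ∑ (h x) f)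
  ∑-concatMap h []       f = refl
  ∑-concatMap h (x ∷ xs) f = trans (∑-++ (h x) (concatMap h xs) f)
                                   (cong (∑ (h x) f +_) (∑-concatMap h xs f))

  ∑-swap : ∀ (xs : List A) (ys : List B) (f : A → B → ℕ) →
           ∑ xs (λ x → ∑ ys (f x)) ≡ ∑ ys (λ y → ∑ xs (λ x → f x y))
  ∑-swap []       ys f = sym (trans (∑-const ys 0) (*-zeroʳ (length ys)))
  ∑-swap (x ∷ xs) ys f = trans (cong (∑ ys (f x) +_) (∑-swap xs ys f))
                               (sym (∑-+ ys (f x) (λ y → ∑ xs (λ x → f x y))))

∑-upTo : ∀ n f → ∑ (upTo n) f ≡ sum (applyUpTo f n)
∑-upTo n f = cong sum (map-upTo f n)

-- Once `f 0` is added, both sides are the sum of `f` over 0, ..., n, because `f n ≡ f 0`.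
∑-shift₁ : ∀ n f → f n ≡ f 0 → ∑ (upTo n) (f ∘ suc) ≡ ∑ (upTo n) f
∑-shift₁ n f fn≡f0 = +-cancelˡ-≡ (f 0) _ _ (begin
  f 0 + ∑ (upTo n) (f ∘ suc)             ≡⟨ cong (f 0 +_) (∑-upTo n (f ∘ suc)) ⟩
  sum (applyUpTo f (suc n))              ≡⟨ cong sum (applyUpTo-∷ʳ f n) ⟨
  sum (applyUpTo f n ++ f n ∷ [])        ≡⟨ sum-++ (applyUpTo f n) (f n ∷ []) ⟩
  sum (applyUpTo f n) + (f n + 0)        ≡⟨ cong (sum (applyUpTo f n) +_) (+-identityʳ (f n)) ⟩
  sum (applyUpTo f n) + f n              ≡⟨ cong₂ _+_ (sym (∑-upTo n f)) fn≡f0 ⟩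
  ∑ (upTo n) f + f 0                     ≡⟨ +-comm _ (f 0) ⟩
  f 0 + ∑ (upTo n) f                     ∎)
  where open ≡-Reasoning

-- A full period has the same sum from whichever index it starts. This serves both for the sizes of
-- arcs and for pairing opposite chains.
∑-shift : ∀ n f → (∀ i → f (i + n) ≡ f i) → ∀ m →
          ∑ (upTo n) (λ i → f (i + m)) ≡ ∑ (upTo n) f
∑-shift n f per zero    = ∑-cong (upTo n) (cong f ∘ +-identityʳ)
∑-shift n f per (suc m) = begin
  ∑ (upTo n) (λ i → f (i + suc m))  ≡⟨ ∑-cong (upTo n) (λ i → cong f (+-suc i m)) ⟩
  ∑ (upTo n) (λ i → f (suc i + m))  ≡⟨ ∑-shift₁ n (λ i → f (i + m)) (trans (cong f (+-comm n m)) (per m)) ⟩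
  ∑ (upTo n) (λ i → f (i + m))      ≡⟨ ∑-shift n f per m ⟩
  ∑ (upTo n) f                      ∎
  where open ≡-Reasoning

-- Indicators of decidable propositions

indicator : {P : Set} → Dec P → ℕ
indicator (yes _) = 1
indicator (no  _) = 0

indicator-yes : {P : Set} (d : Dec P) → P → indicator d ≡ 1
indicator-yes (yes _) p = refl
indicator-yes (no ¬p) p = contradiction p ¬p

module _ {P Q : Set} where

  indicator+indicator≤1 : (d : Dec P) (e : Dec Q) → ¬ (P × Q) → indicator d + indicator e ≤ 1
  indicator+indicator≤1 (yes p) (yes q) ¬pq = contradiction (p , q) ¬pq
  indicator+indicator≤1 (yes _) (no  _) _   = ≤-refl
  indicator+indicator≤1 (no  _) (yes _) _   = ≤-refl
  indicator+indicator≤1 (no  _) (no  _) _   = z≤n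

  indicator+indicator≡0 : (d : Dec P) (e : Dec Q) → ¬ (P ⊎ Q) → indicator d + indicator e ≡ 0
  indicator+indicator≡0 (yes p) _       ¬p⊎q = contradiction (inj₁ p) ¬p⊎q
  indicator+indicator≡0 (no  _) (yes q) ¬p⊎q = contradiction (inj₂ q) ¬p⊎q
  indicator+indicator≡0 (no  _) (no  _) _    = refl

-- The vectors with a given number of ones

level : ∀ n → ℕ → List (Vec Bool n)
level zero    zero    = [] ∷ []
level zero    (suc j) = []
level (suc n) zero    = map (false ∷_) (level n zero)
level (suc n) (suc j) = map (true ∷_) (level n j) ++ map (false ∷_) (level n (suc j))

∑-level-zero : ∀ n f → ∑ (level (suc n) 0) f ≡ ∑ (level n 0) (f ∘ (false ∷_))
∑-level-zero n f = ∑-map (false ∷_) (level n 0) f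

∑-level-suc : ∀ n j f → ∑ (level (suc n) (suc j)) f ≡
              ∑ (level n j) (f ∘ (true ∷_)) + ∑ (level n (suc j)) (f ∘ (false ∷_))
∑-level-suc n j f = trans (∑-++ (map (true ∷_) (level n j)) _ f)
  (cong₂ _+_ (∑-map (true ∷_) (level n j) f) (∑-map (false ∷_) (level n (suc j)) f))

level-term : ∀ {n} (v : Vec Bool n) f → f v ≤ ∑ (level n ∣ v ∣) f
level-term [] f = m≤m+n (f []) 0
level-term {suc n} (true ∷ v) f = begin
  f (true ∷ v)                            ≤⟨ level-term v (f ∘ (true ∷_)) ⟩
  ∑ (level n ∣ v ∣) (f ∘ (true ∷_))         ≤⟨ m≤m+n _ _ ⟩
  _                                       ≡⟨ ∑-level-suc n ∣ v ∣ f ⟨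
  ∑ (level (suc n) (suc ∣ v ∣)) f          ∎
  where open ≤-Reasoning
-- `level (suc n) j` unfolds only once `j` is known to be zero or a successor, so `∣ v ∣` is
-- abstracted together with the induction hypothesis.
level-term {suc n} (false ∷ v) f with ∣ v ∣ | level-term v (f ∘ (false ∷_))
... | zero  | ih = ≤-trans ih (≤-reflexive (sym (∑-level-zero n f)))
... | suc j | ih = ≤-trans ih (≤-trans (m≤n+m _ _) (≤-reflexive (sym (∑-level-suc n j f))))

length-level : ∀ n j → length (level n j) ≡ n C j
length-level zero    zero    = refl
length-level zero    (suc j) = refl
length-level (suc n) zero    = trans (length-map (false ∷_) (level n 0)) (length-level n 0)
length-level (suc n) (suc j) = begin
  length (map (true ∷_) (level n j) ++ map (false ∷_) (level n (suc j)))
    ≡⟨ length-++ (map (true ∷_) (level n j)) ⟩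
  length (map (true ∷_) (level n j)) + length (map (false ∷_) (level n (suc j)))
    ≡⟨ cong₂ _+_ (length-map (true ∷_) (level n j)) (length-map (false ∷_) (level n (suc j))) ⟩
  length (level n j) + length (level n (suc j))
    ≡⟨ cong₂ _+_ (length-level n j) (length-level n (suc j)) ⟩
  n C j + n C suc j
    ≡⟨ nCk+nC[k+1]≡[n+1]C[k+1] n j ⟩
  suc n C suc j ∎
  where open ≡-Reasoning

level-size : ∀ n j → All (λ v → ∣ v ∣ ≡ j) (level n j)
level-size zero    zero    = refl ∷ []
level-size zero    (suc j) = []
level-size (suc n) zero    = All.map⁺ (level-size n 0)
level-size (suc n) (suc j) =
  All.++⁺ (All.map⁺ (All.map (cong suc) (level-size n j))) (All.map⁺ (level-size n (suc j)))

level-unique : ∀ n j → Unique (level n j)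
level-unique zero    zero    = [] ∷ []
level-unique zero    (suc j) = []
level-unique (suc n) zero    = Unique.map⁺ Vec.∷-injectiveʳ (level-unique n 0)
level-unique (suc n) (suc j) =
  Unique.++⁺ (Unique.map⁺ Vec.∷-injectiveʳ (level-unique n j))
             (Unique.map⁺ Vec.∷-injectiveʳ (level-unique n (suc j)))
             (λ { (p , q) → heads-differ (∈-map⁻ (true ∷_) p) (∈-map⁻ (false ∷_) q) })
  where
  heads-differ : ∀ {v : Vec Bool (suc n)} {P Q : Vec Bool n → Set} →
                 ∃[ u ] P u × v ≡ true ∷ u → ∃[ w ] Q w × v ≡ false ∷ w → ⊥
  heads-differ (_ , _ , refl) (_ , _ , ())

-- Orderings

inserts : ∀ {X : Set} {n} → X → Vec X n → List (Vec X (suc n))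
inserts x []      = (x ∷ []) ∷ []
inserts x (y ∷ v) = (x ∷ y ∷ v) ∷ map (y ∷_) (inserts x v)

-- Rearrangements are listed with multiplicity: for a Boolean vector equal words recur, and
-- `∑-perms-level` computes how often.
perms : ∀ {X : Set} {n} → Vec X n → List (Vec X n)
perms []      = [] ∷ []
perms (x ∷ v) = concatMap (inserts x) (perms v)

∑-inserts-∷ : ∀ {X : Set} {n} (x y : X) (v : Vec X n) f →
              ∑ (inserts x (y ∷ v)) f ≡ f (x ∷ y ∷ v) + ∑ (inserts x v) (f ∘ (y ∷_))
∑-inserts-∷ x y v f = cong (f (x ∷ y ∷ v) +_) (∑-map (y ∷_) (inserts x v) f)

∑-inserts-map : ∀ {X Y : Set} {n} (g : X → Y) x (v : Vec X n) f →
                ∑ (inserts x v) (f ∘ Vec.map g) ≡ ∑ (inserts (g x) (Vec.map g v)) f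
∑-inserts-map g x []      f = refl
∑-inserts-map g x (y ∷ v) f = begin
  ∑ (inserts x (y ∷ v)) (f ∘ Vec.map g)
    ≡⟨ ∑-inserts-∷ x y v (f ∘ Vec.map g) ⟩
  f (Vec.map g (x ∷ y ∷ v)) + ∑ (inserts x v) (f ∘ (g y ∷_) ∘ Vec.map g)
    ≡⟨ cong (f (Vec.map g (x ∷ y ∷ v)) +_) (∑-inserts-map g x v (f ∘ (g y ∷_))) ⟩
  f (Vec.map g (x ∷ y ∷ v)) + ∑ (inserts (g x) (Vec.map g v)) (f ∘ (g y ∷_))
    ≡⟨ ∑-inserts-∷ (g x) (g y) (Vec.map g v) f ⟨
  ∑ (inserts (g x) (Vec.map g (y ∷ v))) f ∎
  where open ≡-Reasoning

-- Relabelling the entries commutes with rearranging them. For `g` an arc, a sum over orderings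
-- becomes a sum over the rearrangements of one Boolean word.
∑-perms-map : ∀ {X Y : Set} {n} (g : X → Y) (v : Vec X n) f →
              ∑ (perms v) (f ∘ Vec.map g) ≡ ∑ (perms (Vec.map g v)) f
∑-perms-map g []      f = refl
∑-perms-map g (x ∷ v) f = begin
  ∑ (perms (x ∷ v)) (f ∘ Vec.map g)
    ≡⟨ ∑-concatMap (inserts x) (perms v) _ ⟩
  ∑ (perms v) (λ w → ∑ (inserts x w) (f ∘ Vec.map g))
    ≡⟨ ∑-cong (perms v) (λ w → ∑-inserts-map g x w f) ⟩
  ∑ (perms v) (λ w → ∑ (inserts (g x) (Vec.map g w)) f)
    ≡⟨ ∑-perms-map g v (λ w → ∑ (inserts (g x) w) f) ⟩
  ∑ (perms (Vec.map g v)) (λ w → ∑ (inserts (g x) w) f)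
    ≡⟨ ∑-concatMap (inserts (g x)) (perms (Vec.map g v)) f ⟨
  ∑ (perms (Vec.map g (x ∷ v))) f ∎
  where open ≡-Reasoning

length-inserts : ∀ {X : Set} {n} (x : X) (v : Vec X n) → length (inserts x v) ≡ suc n
length-inserts x []      = refl
length-inserts x (y ∷ v) = cong suc (trans (length-map (y ∷_) (inserts x v)) (length-inserts x v))

∑-perms-const : ∀ {X : Set} {n} (v : Vec X n) c → ∑ (perms v) (λ _ → c) ≡ n ! * c
∑-perms-const []              c = refl
∑-perms-const {n = suc n} (x ∷ v) c = begin
  ∑ (perms (x ∷ v)) (λ _ → c)
    ≡⟨ ∑-concatMap (inserts x) (perms v) _ ⟩
  ∑ (perms v) (λ w → ∑ (inserts x w) (λ _ → c))
    ≡⟨ ∑-cong (perms v) (λ w → trans (∑-const (inserts x w) c) (cong (_* c) (length-inserts x w))) ⟩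
  ∑ (perms v) (λ _ → suc n * c)
    ≡⟨ ∑-perms-const v (suc n * c) ⟩
  n ! * (suc n * c)
    ≡⟨ x*yz≡yx*z (n !) (suc n) c ⟩
  suc n * n ! * c ∎
  where
  open ≡-Reasoning
  x*yz≡yx*z : ∀ x y z → x * (y * z) ≡ y * x * z
  x*yz≡yx*z = solve-∀

-- Each word with `suc j` ones arises once for every one of its ones, namely the one that was
-- inserted.
∑-level-inserts-true : ∀ n j f →
  ∑ (level n j) (λ w → ∑ (inserts true w) f) ≡ suc j * ∑ (level (suc n) (suc j)) f
∑-level-inserts-true zero    zero    f = refl
∑-level-inserts-true zero    (suc j) f = sym (*-zeroʳ j)
∑-level-inserts-true (suc n) zero    f = begin
  ∑ (level (suc n) 0) (λ w → ∑ (inserts true w) f)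
    ≡⟨ ∑-level-zero n _ ⟩
  ∑ (level n 0) (λ w → ∑ (inserts true (false ∷ w)) f)
    ≡⟨ ∑-cong (level n 0) (λ w → ∑-inserts-∷ true false w f) ⟩
  ∑ (level n 0) (λ w → f (true ∷ false ∷ w) + ∑ (inserts true w) (f ∘ (false ∷_)))
    ≡⟨ ∑-+ (level n 0) _ _ ⟩
  ∑ (level n 0) (λ w → f (true ∷ false ∷ w)) + ∑ (level n 0) (λ w → ∑ (inserts true w) (f ∘ (false ∷_)))
    ≡⟨ cong₂ _+_ (sym (∑-level-zero n (f ∘ (true ∷_)))) (∑-level-inserts-true n 0 (f ∘ (false ∷_))) ⟩
  ∑ (level (suc n) 0) (f ∘ (true ∷_)) + 1 * ∑ (level (suc n) 1) (f ∘ (false ∷_))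
    ≡⟨ distrib (∑ (level (suc n) 0) (f ∘ (true ∷_))) _ ⟩
  1 * (∑ (level (suc n) 0) (f ∘ (true ∷_)) + ∑ (level (suc n) 1) (f ∘ (false ∷_)))
    ≡⟨ cong (1 *_) (∑-level-suc (suc n) 0 f) ⟨
  1 * ∑ (level (suc (suc n)) 1) f ∎
  where
  open ≡-Reasoning
  distrib : ∀ a b → a + 1 * b ≡ 1 * (a + b)
  distrib = solve-∀
∑-level-inserts-true (suc n) (suc j) f = begin
  ∑ (level (suc n) (suc j)) (λ w → ∑ (inserts true w) f)
    ≡⟨ ∑-level-suc n j _ ⟩
  ∑ (level n j) (λ w → ∑ (inserts true (true ∷ w)) f) +
  ∑ (level n (suc j)) (λ w → ∑ (inserts true (false ∷ w)) f)
    ≡⟨ cong₂ _+_ (∑-cong (level n j) (λ w → ∑-inserts-∷ true true w f))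
                 (∑-cong (level n (suc j)) (λ w → ∑-inserts-∷ true false w f)) ⟩
  ∑ (level n j) (λ w → f (true ∷ true ∷ w) + ∑ (inserts true w) (f ∘ (true ∷_))) +
  ∑ (level n (suc j)) (λ w → f (true ∷ false ∷ w) + ∑ (inserts true w) (f ∘ (false ∷_)))
    ≡⟨ cong₂ _+_ (∑-+ (level n j) _ _) (∑-+ (level n (suc j)) _ _) ⟩
  (a + ∑ (level n j) (λ w → ∑ (inserts true w) (f ∘ (true ∷_)))) +
  (b + ∑ (level n (suc j)) (λ w → ∑ (inserts true w) (f ∘ (false ∷_))))
    ≡⟨ cong₂ (λ x y → (a + x) + (b + y)) (trans (∑-level-inserts-true n j (f ∘ (true ∷_)))
                                                (cong (suc j *_) (∑-level-suc n j (f ∘ (true ∷_)))))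
                                         (∑-level-inserts-true n (suc j) (f ∘ (false ∷_))) ⟩
  (a + suc j * (a + b)) + (b + suc (suc j) * c)
    ≡⟨ collect j a b c ⟩
  suc (suc j) * ((a + b) + c)
    ≡⟨ cong (λ x → suc (suc j) * (x + c)) (∑-level-suc n j (f ∘ (true ∷_))) ⟨
  suc (suc j) * (∑ (level (suc n) (suc j)) (f ∘ (true ∷_)) + c)
    ≡⟨ cong (suc (suc j) *_) (∑-level-suc (suc n) (suc j) f) ⟨
  suc (suc j) * ∑ (level (suc (suc n)) (suc (suc j))) f ∎
  where
  open ≡-Reasoning
  -- The target level, split by the prefixes true true, true false and false.
  a = ∑ (level n j) (λ w → f (true ∷ true ∷ w))
  b = ∑ (level n (suc j)) (λ w → f (true ∷ false ∷ w))
  c = ∑ (level (suc n) (suc (suc j))) (f ∘ (false ∷_))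
  collect : ∀ j a b c → (a + suc j * (a + b)) + (b + suc (suc j) * c) ≡ suc (suc j) * ((a + b) + c)
  collect = solve-∀

-- The factor is suc n ∸ j, with j moved to the other side.
∑-level-inserts-false : ∀ n j f →
  ∑ (level n j) (λ w → ∑ (inserts false w) f) + j * ∑ (level (suc n) j) f ≡
  suc n * ∑ (level (suc n) j) f
∑-level-inserts-false zero    zero          f = +-identityʳ _
∑-level-inserts-false zero    (suc zero)    f = refl
∑-level-inserts-false zero    (suc (suc j)) f = *-zeroʳ j
∑-level-inserts-false (suc n) zero    f = begin
  ∑ (level (suc n) 0) (λ w → ∑ (inserts false w) f) + 0
    ≡⟨ +-identityʳ _ ⟩
  ∑ (level (suc n) 0) (λ w → ∑ (inserts false w) f)
    ≡⟨ ∑-level-zero n _ ⟩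
  ∑ (level n 0) (λ w → ∑ (inserts false (false ∷ w)) f)
    ≡⟨ ∑-cong (level n 0) (λ w → ∑-inserts-∷ false false w f) ⟩
  ∑ (level n 0) (λ w → f (false ∷ false ∷ w) + ∑ (inserts false w) (f ∘ (false ∷_)))
    ≡⟨ ∑-+ (level n 0) _ _ ⟩
  ∑ (level n 0) (λ w → f (false ∷ false ∷ w)) + ∑ (level n 0) (λ w → ∑ (inserts false w) (f ∘ (false ∷_)))
    ≡⟨ cong₂ _+_ (sym (∑-level-zero n (f ∘ (false ∷_))))
                 (trans (sym (+-identityʳ _)) (∑-level-inserts-false n 0 (f ∘ (false ∷_)))) ⟩
  suc (suc n) * ∑ (level (suc n) 0) (f ∘ (false ∷_))
    ≡⟨ cong (suc (suc n) *_) (∑-level-zero (suc n) f) ⟨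
  suc (suc n) * ∑ (level (suc (suc n)) 0) f ∎
  where open ≡-Reasoning
∑-level-inserts-false (suc n) (suc j) f = begin
  ∑ (level (suc n) (suc j)) (λ w → ∑ (inserts false w) f) + suc j * ∑ (level (suc (suc n)) (suc j)) f
    ≡⟨ cong₂ (λ x y → x + suc j * y) (∑-level-suc n j _) (∑-level-suc (suc n) j f) ⟩
  ∑ (level n j) (λ w → ∑ (inserts false (true ∷ w)) f) +
  ∑ (level n (suc j)) (λ w → ∑ (inserts false (false ∷ w)) f) + suc j * (a + b)
    ≡⟨ cong (_+ suc j * (a + b))
         (cong₂ _+_ (trans (∑-cong (level n j) (λ w → ∑-inserts-∷ false true w f)) (∑-+ (level n j) _ _))
                    (trans (∑-cong (level n (suc j)) (λ w → ∑-inserts-∷ false false w f)) (∑-+ (level n (suc j)) _ _))) ⟩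
  (c + s) + (d + t) + suc j * (a + b)
    -- The insertions in front, `c + d`, make up `b`. One of the `suc j` copies of `a` is set aside
    -- so that `s + j * a` and `t + suc j * b` match the induction hypotheses.
    ≡⟨ regroup j a b c d s t ⟩
  (c + d) + (s + j * a) + (t + suc j * b) + a
    ≡⟨ cong (_+ a) (cong₂ _+_ (cong₂ _+_ (sym (∑-level-suc n j (f ∘ (false ∷_))))
                                         (∑-level-inserts-false n j (f ∘ (true ∷_))))
                              (∑-level-inserts-false n (suc j) (f ∘ (false ∷_)))) ⟩
  b + suc n * a + suc n * b + a
    ≡⟨ collect n a b ⟩
  suc (suc n) * (a + b)
    ≡⟨ cong (suc (suc n) *_) (∑-level-suc (suc n) j f) ⟨
  suc (suc n) * ∑ (level (suc (suc n)) (suc j)) f ∎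
  where
  open ≡-Reasoning
  a = ∑ (level (suc n) j) (f ∘ (true ∷_))
  b = ∑ (level (suc n) (suc j)) (f ∘ (false ∷_))
  c = ∑ (level n j) (λ w → f (false ∷ true ∷ w))
  d = ∑ (level n (suc j)) (λ w → f (false ∷ false ∷ w))
  s = ∑ (level n j) (λ w → ∑ (inserts false w) (f ∘ (true ∷_)))
  t = ∑ (level n (suc j)) (λ w → ∑ (inserts false w) (f ∘ (false ∷_)))
  regroup : ∀ j a b c d s t → (c + s) + (d + t) + suc j * (a + b) ≡
                              (c + d) + (s + j * a) + (t + suc j * b) + a
  regroup = solve-∀
  collect : ∀ n a b → b + suc n * a + suc n * b + a ≡ suc (suc n) * (a + b)
  collect = solve-∀

-- All words of the level recur equally often: inserting the head of the vector multiplies the count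
-- by the number of ones, or of zeros, in the longer word.
∑-perms-level : ∀ {n} (v : Vec Bool n) f →
                ∑ (perms v) f ≡ ∣ v ∣ ! * (n ∸ ∣ v ∣) ! * ∑ (level n ∣ v ∣) f
∑-perms-level [] f = sym (+-identityʳ _)
∑-perms-level {suc n} (true ∷ v) f = begin
  ∑ (perms (true ∷ v)) f
    ≡⟨ ∑-concatMap (inserts true) (perms v) f ⟩
  ∑ (perms v) (λ w → ∑ (inserts true w) f)
    ≡⟨ ∑-perms-level v _ ⟩
  j ! * (n ∸ j) ! * ∑ (level n j) (λ w → ∑ (inserts true w) f)
    ≡⟨ cong (j ! * (n ∸ j) ! *_) (∑-level-inserts-true n j f) ⟩
  j ! * (n ∸ j) ! * (suc j * ∑ (level (suc n) (suc j)) f)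
    ≡⟨ regroup (j !) ((n ∸ j) !) (suc j) _ ⟩
  suc j * j ! * (n ∸ j) ! * ∑ (level (suc n) (suc j)) f ∎
  where
  open ≡-Reasoning
  j = ∣ v ∣
  regroup : ∀ a b c d → a * b * (c * d) ≡ c * a * b * d
  regroup = solve-∀
∑-perms-level {suc n} (false ∷ v) f = begin
  ∑ (perms (false ∷ v)) f
    ≡⟨ ∑-concatMap (inserts false) (perms v) f ⟩
  ∑ (perms v) (λ w → ∑ (inserts false w) f)
    ≡⟨ ∑-perms-level v _ ⟩
  j ! * (n ∸ j) ! * ∑ (level n j) (λ w → ∑ (inserts false w) f)
    -- Writing `suc n` as `suc (n ∸ j) + j` lets `j * e` cancel and leaves the number of zeros as
    -- the factor.
    ≡⟨ cong (j ! * (n ∸ j) ! *_) (+-cancelʳ-≡ (j * e) _ _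
         (trans (∑-level-inserts-false n j f) split)) ⟩
  j ! * (n ∸ j) ! * (suc (n ∸ j) * e)
    ≡⟨ regroup (j !) ((n ∸ j) !) (suc (n ∸ j)) e ⟩
  j ! * suc (n ∸ j) ! * e
    ≡⟨ cong (λ x → j ! * x ! * e) (+-∸-assoc 1 (∣p∣≤n v)) ⟨
  j ! * (suc n ∸ j) ! * e ∎
  where
  open ≡-Reasoning
  j = ∣ v ∣
  e = ∑ (level (suc n) j) f
  split : suc n * e ≡ suc (n ∸ j) * e + j * e
  split = trans (cong (λ x → suc x * e) (sym (m∸n+n≡m (∣p∣≤n v))))
                (*-distribʳ-+ e (suc (n ∸ j)) j)
  regroup : ∀ a b c d → a * b * (c * d) ≡ a * (c * b) * d
  regroup = solve-∀

-- Cyclic arcs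

∣∷∣ : ∀ {n} b (v : Vec Bool n) → ∣ b ∷ v ∣ ≡ indicator (b Bool.≟ true) + ∣ v ∣
∣∷∣ true  v = refl
∣∷∣ false v = refl

-- Turns a size into a sum over natural-number indices, where `∑-shift` applies.
∣tabulate∣ : ∀ n (h : ℕ → Bool) →
             ∣ tabulate {n = n} (h ∘ toℕ) ∣ ≡ sum (applyUpTo (λ i → indicator (h i Bool.≟ true)) n)
∣tabulate∣ zero    h = refl
∣tabulate∣ (suc n) h = trans (∣∷∣ (h 0) (tabulate {n = n} (h ∘ suc ∘ toℕ))) (cong (indicator (h 0 Bool.≟ true) +_) (∣tabulate∣ n (h ∘ suc)))

∣initial∣ : ∀ n j → j ≤ n → ∣ tabulate {n = n} (λ p → toℕ p <ᵇ j) ∣ ≡ j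
∣initial∣ zero    zero    _         = refl
∣initial∣ (suc n) zero    _         = ∣initial∣ n zero z≤n
∣initial∣ (suc n) (suc j) (s≤s j≤n) = cong suc (∣initial∣ n j j≤n)

<ᵇ-true : ∀ {m n} → (m <ᵇ n) ≡ true → m < n
<ᵇ-true {m} {n} e = <ᵇ⇒< m n (subst T (sym e) _)

<ᵇ-false : ∀ {m n} → (m <ᵇ n) ≡ false → ¬ m < n
<ᵇ-false e m<n = subst T e (<⇒<ᵇ m<n)

module Arcs (n : ℕ) .{{_ : NonZero n}} where

  -- Positions are counted backwards: this is the arc of length j that starts at -i.
  arc : ℕ → ℕ → Fin n → Bool
  arc i j p = (toℕ p + i) % n <ᵇ j

  -- `π` assigns to each element of [n] its position in the ordering; the result is the set of
  -- elements whose positions lie in the arc.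
  chain : ℕ → ℕ → Vec (Fin n) n → Vec Bool n
  chain i j = Vec.map (arc i j)

  arc-periodic : ∀ i j p → arc (i + n) j p ≡ arc i j p
  arc-periodic i j p = cong (_<ᵇ j)
    (trans (cong (_% n) (sym (+-assoc (toℕ p) i n))) ([m+n]%n≡m%n (toℕ p + i) n))

  chain-periodic : ∀ i j π → chain (i + n) j π ≡ chain i j π
  chain-periodic i j = Vec.map-cong (arc-periodic i j)

  -- Membership of `p` depends on `p + i` with period `n`, so the size is the same as for `i` equal
  -- to 0, where the arc is the first `j` positions.
  ∣arc∣ : ∀ i {j} → j ≤ n → ∣ chain i j (allFin n) ∣ ≡ j
  ∣arc∣ i {j} j≤n = begin
    ∣ chain i j (allFin n) ∣                  ≡⟨ cong ∣_∣ (Vec.tabulate-allFin (arc i j)) ⟨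
    ∣ tabulate (arc i j) ∣                    ≡⟨ ∣tabulate∣ n (λ p → (p + i) % n <ᵇ j) ⟩
    sum (applyUpTo (λ p → bit (p + i)) n)    ≡⟨ ∑-upTo n (λ p → bit (p + i)) ⟨
    ∑ (upTo n) (λ p → bit (p + i))           ≡⟨ ∑-shift n bit periodic i ⟩
    ∑ (upTo n) bit                           ≡⟨ ∑-upTo n bit ⟩
    sum (applyUpTo bit n)                    ≡⟨ ∣tabulate∣ n (λ p → p % n <ᵇ j) ⟨
    ∣ tabulate {n = n} (λ p → toℕ p % n <ᵇ j) ∣
      ≡⟨ cong ∣_∣ (Vec.tabulate-cong (λ p → cong (_<ᵇ j) (m<n⇒m%n≡m (toℕ<n p)))) ⟩
    ∣ tabulate {n = n} (λ p → toℕ p <ᵇ j) ∣   ≡⟨ ∣initial∣ n j j≤n ⟩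
    j                                        ∎
    where
    open ≡-Reasoning
    bit : ℕ → ℕ
    bit p = indicator ((p % n <ᵇ j) Bool.≟ true)
    periodic : ∀ p → bit (p + n) ≡ bit p
    periodic p = cong (λ x → indicator ((x <ᵇ j) Bool.≟ true)) ([m+n]%n≡m%n p n)

  -- A position with offset `q < m` in the first arc has offset `q + m` relative to the second. As
  -- `q + m < n` there is no wrap-around, and this offset is too large for an arc of length at most
  -- `m`.
  arcs-disjoint : ∀ i {m j k} p → m + m ≤ n → j ≤ m → k ≤ m →
                  arc i j p ≡ true → arc (i + m) k p ≡ true → ⊥
  arcs-disjoint i {m} {j} {k} p 2m≤n j≤m k≤m pj pk =
    <⇒≱ (subst (_< m) shifted (<-≤-trans (<ᵇ-true pk) k≤m)) (m≤n+m m q)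
    where
    q = (toℕ p + i) % n
    q<m : q < m
    q<m = <-≤-trans (<ᵇ-true pj) j≤m
    q+m<n : q + m < n
    q+m<n = <-≤-trans (+-monoˡ-< m q<m) 2m≤n
    m<n : m < n
    m<n = ≤-<-trans (m≤n+m m q) q+m<n
    shifted : (toℕ p + (i + m)) % n ≡ q + m
    shifted = begin
      (toℕ p + (i + m)) % n  ≡⟨ cong (_% n) (+-assoc (toℕ p) i m) ⟨
      (toℕ p + i + m) % n    ≡⟨ %-distribˡ-+ (toℕ p + i) m n ⟩
      (q + m % n) % n        ≡⟨ cong (λ x → (q + x) % n) (m<n⇒m%n≡m m<n) ⟩
      (q + m) % n            ≡⟨ m<n⇒m%n≡m q+m<n ⟩
      q + m                  ∎
      where open ≡-Reasoning

  -- Only the arc of length `∣ v ∣` in a chain can be `v`, so membership in the chain is a single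
  -- equation.
  Hit : ℕ → Vec (Fin n) n → Vec Bool n → Set
  Hit i π v = v ≡ chain i ∣ v ∣ π

  lookup-hit : ∀ i π v r {b} → Hit i π v → lookup v r ≡ b → arc i ∣ v ∣ (lookup π r) ≡ b
  lookup-hit i π v r h e =
    trans (sym (trans (cong (λ w → lookup w r) h) (Vec.lookup-map r (arc i ∣ v ∣) π))) e

  hit? : ∀ i π v → Dec (Hit i π v)
  hit? i π v = Vec.≡-dec Bool._≟_ v (chain i ∣ v ∣ π)

  hit : ℕ → Vec (Fin n) n → Vec Bool n → ℕ
  hit i π v = indicator (hit? i π v)

  hit-periodic : ∀ i π v → hit (i + n) π v ≡ hit i π v
  hit-periodic i π v = cong (λ w → indicator (Vec.≡-dec Bool._≟_ v w)) (chain-periodic i ∣ v ∣ π)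

  -- As the ordering varies, the fixed arc runs through all rearrangements of a word with as many
  -- ones as `v`, and `v` is one of them.
  hits-perms : ∀ i v → ∣ v ∣ ! * (n ∸ ∣ v ∣) ! ≤ ∑ (perms (allFin n)) (λ π → hit i π v)
  hits-perms i v = begin
    c                                     ≡⟨ *-identityʳ c ⟨
    c * 1                                 ≡⟨ cong (c *_) (indicator-yes (v ≟ v) refl) ⟨
    c * δ v                               ≤⟨ *-monoʳ-≤ c (level-term v δ) ⟩
    -- `w` has `∣ v ∣` ones too; restating everything with `∣ w ∣` gives the form of
    -- `∑-perms-level`.
    c * ∑ (level n ∣ v ∣) δ                ≡⟨ cong (λ j → j ! * (n ∸ j) ! * ∑ (level n j) δ) (∣arc∣ i (∣p∣≤n v)) ⟨
    _                                     ≡⟨ ∑-perms-level w δ ⟨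
    ∑ (perms w) δ                         ≡⟨ ∑-perms-map (arc i ∣ v ∣) (allFin n) δ ⟨
    ∑ (perms (allFin n)) (λ π → hit i π v) ∎
    where
    open ≤-Reasoning
    _≟_ = Vec.≡-dec Bool._≟_
    c = ∣ v ∣ ! * (n ∸ ∣ v ∣) !
    w = chain i ∣ v ∣ (allFin n)
    δ : Vec Bool n → ℕ
    δ u = indicator (v ≟ u)

  module _ {m} (2m≤n : m + m ≤ n) where

    Light : Vec Bool n → Set
    Light v = ∣ v ∣ ≤ m

    -- Arcs with a common start are nested, so no coordinate has a one in the shorter and a zero in
    -- the longer.
    same-chain : ∀ i π u v → Hit i π u → Hit i π v → ¬ RealisesAll u v
    same-chain i π u v hu hv all with ≤-total ∣ u ∣ ∣ v ∣
    ... | inj₁ u≤v = let r , e = all (true , false) in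
      <ᵇ-false (lookup-hit i π v r hv (,-injectiveʳ e))
        (<-≤-trans (<ᵇ-true (lookup-hit i π u r hu (,-injectiveˡ e))) u≤v)
    ... | inj₂ v≤u = let r , e = all (false , true) in
      <ᵇ-false (lookup-hit i π u r hu (,-injectiveˡ e))
        (<-≤-trans (<ᵇ-true (lookup-hit i π v r hv (,-injectiveʳ e))) v≤u)

    opposite-chains : ∀ i π u v {r} → Light u → Light v → Hit i π u → Hit (i + m) π v →
                      lookup u r ≡ true → lookup v r ≡ true → ⊥
    opposite-chains i π u v {r} u≤m v≤m hu hv eu ev =
      arcs-disjoint i (lookup π r) 2m≤n u≤m v≤m
        (lookup-hit i π u r hu eu) (lookup-hit (i + m) π v r hv ev)

    not-both-hit : ∀ i π u v → Light u → Light v → RealisesAll u v →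
                   Hit i π u ⊎ Hit (i + m) π u → Hit i π v ⊎ Hit (i + m) π v → ⊥
    not-both-hit i π u v lu lv all (inj₁ hu) (inj₁ hv) = same-chain i π u v hu hv all
    not-both-hit i π u v lu lv all (inj₂ hu) (inj₂ hv) = same-chain (i + m) π u v hu hv all
    not-both-hit i π u v lu lv all (inj₁ hu) (inj₂ hv) =
      let r , e = all (true , true) in opposite-chains i π u v lu lv hu hv (,-injectiveˡ e) (,-injectiveʳ e)
    not-both-hit i π u v lu lv all (inj₂ hu) (inj₁ hv) =
      let r , e = all (true , true) in opposite-chains i π v u lv lu hv hu (,-injectiveʳ e) (,-injectiveˡ e)

    module _ {vs : List (Vec Bool n)} (light : All Light vs)
             (nonempty : All (λ v → ∃[ r ] lookup v r ≡ true) vs)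
             (pairs : AllPairs RealisesAll vs) where

      hits-opposite : ∀ i π → ∑ vs (hit i π) + ∑ vs (hit (i + m) π) ≤ 1
      hits-opposite i π = begin
        ∑ vs (hit i π) + ∑ vs (hit (i + m) π)        ≡⟨ ∑-+ vs (hit i π) (hit (i + m) π) ⟨
        ∑ vs (λ v → hit i π v + hit (i + m) π v)     ≤⟨ ∑≤1 (each light nonempty) (exclusive light pairs) ⟩
        1                                            ∎
        where
        open ≤-Reasoning
        each : ∀ {vs} → All Light vs → All (λ v → ∃[ r ] lookup v r ≡ true) vs →
               All (λ v → hit i π v + hit (i + m) π v ≤ 1) vs
        each []       []             = []
        -- A vector in both chains would be disjoint from itself, although it contains a one.
        each {v ∷ _} (l ∷ ls) ((r , e) ∷ es) =
          indicator+indicator≤1 (hit? i π v) (hit? (i + m) π v)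
            (λ (h , h′) → opposite-chains i π v v l l h h′ e e) ∷ each ls es
        clash : ∀ u v → Light u → Light v → RealisesAll u v →
                hit i π u + hit (i + m) π u ≡ 0 ⊎ hit i π v + hit (i + m) π v ≡ 0
        clash u v lu lv all with hit? i π u ⊎-dec hit? (i + m) π u
        ... | no ¬h = inj₁ (indicator+indicator≡0 (hit? i π u) (hit? (i + m) π u) ¬h)
        ... | yes h = inj₂ (indicator+indicator≡0 (hit? i π v) (hit? (i + m) π v)
                              (not-both-hit i π u v lu lv all h))
        exclusive : ∀ {vs} → All Light vs → AllPairs RealisesAll vs →
                    AllPairs (λ u v → hit i π u + hit (i + m) π u ≡ 0 ⊎ hit i π v + hit (i + m) π v ≡ 0) vs
        exclusive []       []       = []
        exclusive {u ∷ _} (l ∷ ls) (p ∷ ps) =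
          All.zipWith (λ {v} (l′ , q) → clash u v l l′ q) (ls , p) ∷ exclusive ls ps

      -- Summed over `i`, `hits-opposite` counts every chain twice, since the shift by `m` only
      -- rotates the indices. Hence `Y + Y ≤ n`, and halving gives the bound.
      hits-cycle : ∀ π → ∑ (upTo n) (λ i → ∑ vs (hit i π)) ≤ ⌊ n /2⌋
      hits-cycle π = subst (_≤ ⌊ n /2⌋) (sym (n≡⌊n+n/2⌋ Y)) (⌊n/2⌋-mono (begin
        Y + Y                                ≡⟨ cong (Y +_) (∑-shift n y (λ i → ∑-cong vs (hit-periodic i π)) m) ⟨
        Y + ∑ (upTo n) (λ i → y (i + m))     ≡⟨ ∑-+ (upTo n) y (λ i → y (i + m)) ⟨
        ∑ (upTo n) (λ i → y i + y (i + m))   ≤⟨ ∑-mono (All.universal (λ i → hits-opposite i π) (upTo n)) ⟩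
        ∑ (upTo n) (λ _ → 1)                 ≡⟨ ∑-const (upTo n) 1 ⟩
        length (upTo n) * 1                  ≡⟨ *-identityʳ _ ⟩
        length (upTo n)                      ≡⟨ length-upTo n ⟩
        n                                    ∎))
        where
        open ≤-Reasoning
        y : ℕ → ℕ
        y i = ∑ vs (hit i π)
        Y = ∑ (upTo n) y

-- Double counting over all orderings

-- Going from `k` to `suc k` trades a factor `n ∸ k` for `suc k`, which is no larger below the
-- middle. The induction is on the gap `d`.
factorials-decrease : ∀ {n} d j → (d + j) + (d + j) ≤ n →
                      (d + j) ! * (n ∸ (d + j)) ! ≤ j ! * (n ∸ j) !
factorials-decrease zero    j _ = ≤-refl
factorials-decrease {n} (suc d) j 2k≤n = ≤-trans step (factorials-decrease d j k+k≤n)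
  where
  k = d + j
  k+k≤n : k + k ≤ n
  k+k≤n = ≤-trans (+-mono-≤ (n≤1+n k) (n≤1+n k)) 2k≤n
  1+k≤n : suc k ≤ n
  1+k≤n = ≤-trans (m≤m+n (suc k) (suc k)) 2k≤n
  n∸k : n ∸ k ≡ suc (n ∸ suc k)
  n∸k = +-∸-assoc 1 1+k≤n
  regroup : ∀ a b c → a * b * c ≡ b * (a * c)
  regroup = solve-∀
  step : suc k ! * (n ∸ suc k) ! ≤ k ! * (n ∸ k) !
  step = begin
    suc k * k ! * (n ∸ suc k) !                ≤⟨ *-monoˡ-≤ ((n ∸ suc k) !) (*-monoˡ-≤ (k !) (≤-trans (m+n≤o⇒m≤o∸n (suc k) 2k≤n) (n≤1+n _))) ⟩
    suc (n ∸ suc k) * k ! * (n ∸ suc k) !      ≡⟨ regroup (suc (n ∸ suc k)) (k !) ((n ∸ suc k) !) ⟩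
    k ! * suc (n ∸ suc k) !                    ≡⟨ cong (λ x → k ! * x !) n∸k ⟨
    k ! * (n ∸ k) !                            ∎
    where open ≤-Reasoning

nCk*k![n∸k]!≡n! : ∀ {n k} → k ≤ n → (n C k) * (k ! * (n ∸ k) !) ≡ n !
nCk*k![n∸k]!≡n! {n} {k} k≤n = trans (cong (_* (k ! * (n ∸ k) !)) (nCk≡n!/k![n-k]! k≤n))
                                    (m/n*n≡m (k![n∸k]!∣n! k≤n))
  where instance _ = k !* (n ∸ k) !≢0

-- Triples of a member, a rotation and an ordering in which the member is hit are counted in two
-- ways: at least `n * c` for each member, at most `m` for each ordering.
light-bound : ∀ N M → ⌊ suc N /2⌋ ≡ suc M → {vs : List (Vec Bool (suc N))} →
              All (λ v → ∣ v ∣ ≤ suc M) vs → All (λ v → ∃[ r ] lookup v r ≡ true) vs →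
              AllPairs RealisesAll vs → length vs ≤ N C M
light-bound N M half {vs} light nonempty pairs =
  *-cancelʳ-≤ (length vs) (N C M) (n * c) (begin
    length vs * (n * c)
      ≡⟨ ∑-const vs (n * c) ⟨
    ∑ vs (λ _ → n * c)
      ≤⟨ ∑-mono (All.map frequent light) ⟩
    ∑ vs (λ v → ∑ (upTo n) (λ i → ∑ Π (λ π → hit i π v)))
      ≡⟨ ∑-cong vs (λ v → ∑-swap (upTo n) Π (λ i π → hit i π v)) ⟩
    ∑ vs (λ v → ∑ Π (λ π → ∑ (upTo n) (λ i → hit i π v)))
      ≡⟨ ∑-swap vs Π _ ⟩
    ∑ Π (λ π → ∑ vs (λ v → ∑ (upTo n) (λ i → hit i π v)))
      ≡⟨ ∑-cong Π (λ π → ∑-swap vs (upTo n) (λ v i → hit i π v)) ⟩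
    ∑ Π (λ π → ∑ (upTo n) (λ i → ∑ vs (hit i π)))
      ≤⟨ ∑-mono (All.universal (λ π → ≤-trans (hits-cycle 2m≤n light nonempty pairs π) (≤-reflexive half)) Π) ⟩
    ∑ Π (λ _ → m)
      ≡⟨ ∑-perms-const (allFin n) m ⟩
    n * N ! * m
      -- `m * M !` is `m !` and `N ∸ M` is `n ∸ m` by computation, so `N C M` splits off and `n * c`
      -- remains.
      ≡⟨ cong (λ x → n * x * m) (nCk*k![n∸k]!≡n! M≤N) ⟨
    n * ((N C M) * (M ! * (N ∸ M) !)) * m
      ≡⟨ regroup n (N C M) (M !) ((N ∸ M) !) m ⟩
    (N C M) * (n * c) ∎)
  where
  open ≤-Reasoning
  n = suc N
  m = suc M
  open Arcs n
  Π = perms (allFin n)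
  c = m ! * (n ∸ m) !
  instance
    _ = m !* (n ∸ m) !≢0
    _ = m*n≢0 n c
  2m≤n : m + m ≤ n
  2m≤n = subst (λ x → x + x ≤ n) half
           (≤-trans (+-monoʳ-≤ ⌊ n /2⌋ (⌊n/2⌋≤⌈n/2⌉ n)) (≤-reflexive (⌊n/2⌋+⌈n/2⌉≡n n)))
  M≤N : M ≤ N
  M≤N = ≤-pred (≤-trans (m≤m+n m m) 2m≤n)
  regroup : ∀ a b c d e → a * (b * (c * d)) * e ≡ b * (a * (e * c * d))
  regroup = solve-∀
  frequent : ∀ {v} → ∣ v ∣ ≤ m → n * c ≤ ∑ (upTo n) (λ i → ∑ Π (λ π → hit i π v))
  frequent {v} v≤m = begin
    n * c                                        ≡⟨ cong (_* c) (length-upTo n) ⟨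
    length (upTo n) * c                          ≡⟨ ∑-const (upTo n) c ⟨
    ∑ (upTo n) (λ _ → c)                         ≤⟨ ∑-mono (All.universal (λ i → ≤-trans c≤ (hits-perms i v)) (upTo n)) ⟩
    ∑ (upTo n) (λ i → ∑ Π (λ π → hit i π v))     ∎
    where
    -- A smaller set is an arc at least as often as a set of size `m`.
    c≤ : c ≤ ∣ v ∣ ! * (n ∸ ∣ v ∣) !
    c≤ = subst (λ x → x ! * (n ∸ x) ! ≤ ∣ v ∣ ! * (n ∸ ∣ v ∣) !) (m∸n+n≡m v≤m)
           (factorials-decrease (m ∸ ∣ v ∣) ∣ v ∣
             (subst (λ x → x + x ≤ n) (sym (m∸n+n≡m v≤m)) 2m≤n))

-- Complementation

-- The pattern `(a , b)` occurs for the complement exactly where `(not a , b)` occurs for `u`.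
realisesAll-∁ˡ : ∀ {n} (u v : Vec Bool n) → RealisesAll u v → RealisesAll (∁ u) v
realisesAll-∁ˡ u v all (a , b) with all (not a , b)
... | r , e = r , cong₂ _,_ (trans (Vec.lookup-map r not u)
                                   (trans (cong not (,-injectiveˡ e)) (Bool.not-involutive a)))
                            (,-injectiveʳ e)

realisesAll-∁ʳ : ∀ {n} (u v : Vec Bool n) → RealisesAll u v → RealisesAll u (∁ v)
realisesAll-∁ʳ u v all (a , b) with all (a , not b)
... | r , e = r , cong₂ _,_ (,-injectiveˡ e)
                            (trans (Vec.lookup-map r not v)
                                   (trans (cong not (,-injectiveʳ e)) (Bool.not-involutive b)))

lighten : ∀ {n} → Vec Bool n → Vec Bool n
lighten {n} v with ∣ v ∣ ≤? ⌊ n /2⌋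
... | yes _ = v
... | no  _ = ∁ v

∣lighten∣ : ∀ {n} (v : Vec Bool n) → ∣ lighten v ∣ ≤ ⌊ n /2⌋
∣lighten∣ {n} v with ∣ v ∣ ≤? ⌊ n /2⌋
... | yes v≤ = v≤
... | no  v≰ = begin
  ∣ ∁ v ∣               ≡⟨ ∣∁p∣≡n∸∣p∣ v ⟩
  n ∸ ∣ v ∣             ≤⟨ ∸-monoʳ-≤ n (≰⇒> v≰) ⟩
  n ∸ suc ⌊ n /2⌋      ≤⟨ m≤n+o⇒m∸n≤o n (suc ⌊ n /2⌋) n≤ ⟩
  ⌊ n /2⌋              ∎
  where
  open ≤-Reasoning
  n≤ : n ≤ suc ⌊ n /2⌋ + ⌊ n /2⌋
  n≤ = begin
    n                          ≡⟨ ⌊n/2⌋+⌈n/2⌉≡n n ⟨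
    -- `⌈ n /2⌉` is `⌊ suc n /2⌋`, and `suc ⌊ n /2⌋` is `⌊ suc (suc n) /2⌋`.
    ⌊ n /2⌋ + ⌈ n /2⌉          ≤⟨ +-monoʳ-≤ ⌊ n /2⌋ (⌊n/2⌋-mono (n≤1+n (suc n))) ⟩
    ⌊ n /2⌋ + suc ⌊ n /2⌋      ≡⟨ +-comm ⌊ n /2⌋ _ ⟩
    suc ⌊ n /2⌋ + ⌊ n /2⌋      ∎

realisesAll-lighten : ∀ {n} (u v : Vec Bool n) → RealisesAll u v → RealisesAll (lighten u) (lighten v)
realisesAll-lighten {n} u v all with ∣ u ∣ ≤? ⌊ n /2⌋ | ∣ v ∣ ≤? ⌊ n /2⌋
... | yes _ | yes _ = all
... | yes _ | no  _ = realisesAll-∁ʳ u v all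
... | no  _ | yes _ = realisesAll-∁ˡ u v all
... | no  _ | no  _ = realisesAll-∁ʳ (∁ u) v (realisesAll-∁ˡ u v all)

-- With at least two members each one has a partner, and the pattern `(true , true)` shared with it
-- supplies a one.
all-nonempty : ∀ {n} {vs : List (Vec Bool n)} → 2 ≤ length vs → AllPairs RealisesAll vs →
               All (λ v → ∃[ r ] lookup v r ≡ true) vs
all-nonempty {vs = u ∷ v ∷ _} (s≤s (s≤s _)) ((p ∷ ps) ∷ _) =
  left u v p ∷ All.map (λ {w} → right u w) (p ∷ ps)
  where
  left : ∀ {n} (u v : Vec Bool n) → RealisesAll u v → ∃[ r ] lookup u r ≡ true
  left u v all = let r , e = all (true , true) in r , ,-injectiveˡ e
  right : ∀ {n} (u v : Vec Bool n) → RealisesAll u v → ∃[ r ] lookup v r ≡ true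
  right u v all = let r , e = all (true , true) in r , ,-injectiveʳ e

perfect-bound : ∀ N M → ⌊ suc N /2⌋ ≡ suc M → (V : VectorSet (suc N)) → Perfect V → size V ≤ N C M
perfect-bound N M half V perfect = begin
  length vs                ≡⟨ length-map lighten vs ⟨
  length (map lighten vs)  ≤⟨ light-bound N M half light (all-nonempty two pairs) pairs ⟩
  N C M                    ∎
  where
  open ≤-Reasoning
  vs = elements V
  two : 2 ≤ length (map lighten vs)
  two = subst (2 ≤_) (sym (length-map lighten vs)) (Perfect.size≥2 perfect)
  light : All (λ v → ∣ v ∣ ≤ suc M) (map lighten vs)
  light = All.map⁺ (All.universal (λ v → subst (∣ lighten v ∣ ≤_) half (∣lighten∣ v)) vs)
  pairs : AllPairs RealisesAll (map lighten vs)
  pairs = AllPairs.map⁺ (AllPairs.map (λ {u} {v} → realisesAll-lighten u v) (Perfect.pairwise perfect))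

-- The extremal family

_occursIn_,_ : ∀ {n} → Bool × Bool → Vec Bool n → Vec Bool n → Set
α occursIn u , v = ∃[ r ] (lookup u r , lookup v r) ≡ α

occurs-suc : ∀ {n α a b} {u v : Vec Bool n} → α occursIn u , v → α occursIn (a ∷ u) , (b ∷ v)
occurs-suc (r , e) = suc r , e

-- Without the pattern, the ones of `u` would be among those of `v`, and `∣ v ∣ ≤ ∣ u ∣` would force
-- equality.
occurs-TF : ∀ {n} (u v : Vec Bool n) → ∣ v ∣ ≤ ∣ u ∣ → u ≢ v → (true , false) occursIn u , v
occurs-TF []          []          _   u≢v = contradiction refl u≢v
occurs-TF (true  ∷ u) (false ∷ v) _   _   = zero , refl
occurs-TF (true  ∷ u) (true  ∷ v) v≤u u≢v = occurs-suc (occurs-TF u v (≤-pred v≤u) (u≢v ∘ cong (true ∷_)))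
occurs-TF (false ∷ u) (false ∷ v) v≤u u≢v = occurs-suc (occurs-TF u v v≤u (u≢v ∘ cong (false ∷_)))
-- The tail of the first vector now has strictly more ones, which already makes the tails differ.
occurs-TF (false ∷ u) (true  ∷ v) v<u _   = occurs-suc (occurs-TF u v (<⇒≤ v<u) λ { refl → <-irrefl refl v<u })

-- Fewer than `n` ones in total cannot cover all `n` coordinates.
occurs-FF : ∀ {n} (u v : Vec Bool n) → ∣ u ∣ + ∣ v ∣ < n → (false , false) occursIn u , v
occurs-FF (false ∷ u) (false ∷ v) _    = zero , refl
occurs-FF (true  ∷ u) (false ∷ v) u+v< = occurs-suc (occurs-FF u v (≤-pred u+v<))
occurs-FF (false ∷ u) (true  ∷ v) u+v< =
  occurs-suc (occurs-FF u v (≤-pred (≤-trans (≤-reflexive (cong suc (sym (+-suc ∣ u ∣ ∣ v ∣)))) u+v<)))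
occurs-FF (true  ∷ u) (true  ∷ v) u+v< =
  occurs-suc (occurs-FF u v (≤-trans (+-monoʳ-< ∣ u ∣ (n<1+n ∣ v ∣)) (≤-pred (<⇒≤ u+v<))))

-- The common first one gives `(true , true)`. Distinct tails of equal size give both mixed
-- patterns, and `j + j < n` leaves a coordinate where both tails are zero.
star-realises : ∀ {n j} (u v : Vec Bool n) → j + j < n → ∣ u ∣ ≡ j → ∣ v ∣ ≡ j → u ≢ v →
                RealisesAll (true ∷ u) (true ∷ v)
star-realises _ _ _ _ _ _ (true , true) = zero , refl
star-realises u v _ refl v≡j u≢v (true , false) =
  occurs-suc (occurs-TF u v (≤-reflexive v≡j) u≢v)
star-realises u v _ refl v≡j u≢v (false , true)
  with r , e ← occurs-TF v u (≤-reflexive (sym v≡j)) (u≢v ∘ sym) =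
  suc r , cong₂ _,_ (,-injectiveʳ e) (,-injectiveˡ e)
star-realises u v 2j<n refl v≡j _ (false , false) =
  occurs-suc (occurs-FF u v (subst (λ x → ∣ u ∣ + x < _) (sym v≡j) 2j<n))

star : ∀ N j → VectorSet (suc N)
star N j = record
  { elements = map (true ∷_) (level N j)
  ; unique   = Unique.map⁺ Vec.∷-injectiveʳ (level-unique N j)
  }

size-star : ∀ N j → size (star N j) ≡ N C j
size-star N j = trans (length-map (true ∷_) (level N j)) (length-level N j)

star-perfect : ∀ N j → j + j < N → 2 ≤ N C j → Perfect (star N j)
star-perfect N j 2j<N two = record
  { size≥2   = subst (2 ≤_) (sym (size-star N j)) two
  ; pairwise = AllPairs.map⁺ (pairs (level-size N j) (level-unique N j))
  }
  where
  pairs : ∀ {us} → All (λ u → ∣ u ∣ ≡ j) us → Unique us →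
          AllPairs (λ u v → RealisesAll (true ∷ u) (true ∷ v)) us
  pairs []       []       = []
  pairs {u ∷ _} (s ∷ ss) (p ∷ ps) =
    All.zipWith (λ {v} (s′ , u≢v) → star-realises u v 2j<N s s′ u≢v) (ss , p) ∷ pairs ss ps

-- The exact value of the maximum

nCk>0 : ∀ {n k} → k ≤ n → 0 < n C k
nCk>0 {n} {k} k≤n = n≢0⇒n>0 λ e →
  <⇒≢ (1≤n! n) (trans (cong (_* (k ! * (n ∸ k) !)) (sym e)) (nCk*k![n∸k]!≡n! k≤n))

theorem2 : (n : ℕ) → 4 ≤ n → p[ n ]≡ ((n ∸ 1) C (⌊ n /2⌋ ∸ 1))
theorem2 (suc (suc (suc (suc k)))) (s≤s (s≤s (s≤s (s≤s _)))) =
  (star N M , star-perfect N M 2M<N two , size-star N M) ,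
  λ { _ (V , perfect , refl) → perfect-bound N M refl V perfect }
  where
  N = suc (suc (suc k))
  -- For `n` equal to `k + 4` this is `⌊ n /2⌋ ∸ 1` by computation, and `⌊ suc N /2⌋` reduces to
  -- `suc M`, hence the `refl` passed to `perfect-bound`.
  M = suc ⌊ k /2⌋
  2M<N : M + M < N
  2M<N = s≤s (subst (_≤ suc (suc k)) (sym (cong suc (+-suc ⌊ k /2⌋ ⌊ k /2⌋)))
    (s≤s (s≤s (≤-trans (+-monoʳ-≤ ⌊ k /2⌋ (⌊n/2⌋≤⌈n/2⌉ k)) (≤-reflexive (⌊n/2⌋+⌈n/2⌉≡n k))))))
  -- Pascal's rule writes the coefficient as a sum of two positive ones.
  two : 2 ≤ N C M
  two = begin
    2                                            ≤⟨ +-mono-≤ (nCk>0 ⌊k/2⌋≤2+k) (nCk>0 M≤2+k) ⟩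
    suc (suc k) C ⌊ k /2⌋ + suc (suc k) C M       ≡⟨ nCk+nC[k+1]≡[n+1]C[k+1] (suc (suc k)) ⌊ k /2⌋ ⟩
    N C M                                        ∎
    where
    open ≤-Reasoning
    M≤2+k : M ≤ suc (suc k)
    M≤2+k = s≤s (≤-trans (⌊n/2⌋≤n k) (n≤1+n k))
    ⌊k/2⌋≤2+k : ⌊ k /2⌋ ≤ suc (suc k)
    ⌊k/2⌋≤2+k = <⇒≤ M≤2+k
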